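{- The exponential generating function $g(x,y)=g(x,y;p,q,r)=\sum_{n\ge1}b_n(y;p,q,r)\frac{x^n}{n!}$ satisfies $$\frac{\partial}{\partial x}g(x,y)=y+\left(p+\frac{yr-q}{1-y}\right)g(x,y)+\frac{y}{1-y}\bigl(q\,g(x,1)-yr\,g(xy,1)\bigr).$$
   Context: An inversion sequence of length $n$ is a sequence $\rho=\rho_1\cdots\rho_n$ of integers with $1\le \rho_i\le i$ for all $i$; $I_{n,i}$ is the set of those of length $n$ with last letter $i$. A level, descent, or ascent of $\rho$ is an index $i\in[n-1]$ with $\rho_i=\rho_{i+1}$, $\rho_i>\rho_{i+1}$, or $\rho_i<\rho_{i+1}$, respectively. Let $b_{n,i}(p,q,r)=\sum_{\rho\in I_{n,i}}p^{\mathrm{lev}(\rho)}q^{\mathrm{des}(\rho)}r^{\mathrm{asc}(\rho)}$ (numbers of levels, descents, ascents) and $b_n(y;p,q,r)=\sum_{i=1}^n b_{n,i}(p,q,r)y^i$. -}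

module Defs where

open import Algebra.Bundles using (CommutativeRing; Semiring)
open import Algebra.Morphism.Structures using (IsRingHomomorphism)
open import Data.Fin.Base using (Fin; toℕ)
open import Data.Fin.Properties using (all?)
open import Data.Integer.Base using (+_)
open import Data.List.Base using (List; []; [_]; map; filter; foldr; upTo; cartesianProductWith)
open import Data.Nat.Base using (ℕ; zero; suc; pred; _≤_; _!)
open import Data.Nat.Properties using (_≟_; _≤?_; _<?_; _>?_; _!≢0)
open import Data.Product.Base using (_×_; _,_)
open import Data.Rational.Base as ℚ using (ℚ)
open import Data.Vec.Base as Vec using (Vec; []; _∷_; lookup)
open import Level as Level using (Level; _⊔_)
open import Relation.Nullary.Decidable.Core using (Dec; _×-dec_)

import Algebra.Definitions.RawSemiring as RawSemiringDefinitions

[1⋯_] : ℕ → List ℕ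
[1⋯ n ] = map suc (upTo n)

IsInversionSequence : ∀ {n} → Vec ℕ n → Set
IsInversionSequence {n} ρ =
  (i : Fin n) → 1 ≤ lookup ρ i × lookup ρ i ≤ suc (toℕ i)

isInversionSequence? : ∀ {n} (ρ : Vec ℕ n) → Dec (IsInversionSequence ρ)
isInversionSequence? ρ =
  all? λ i → (1 ≤? lookup ρ i) ×-dec (lookup ρ i ≤? suc (toℕ i))

words : List ℕ → (n : ℕ) → List (Vec ℕ n)
words letters zero    = [ [] ]
words letters (suc n) = cartesianProductWith _∷_ letters (words letters n)

-- Each element of I_{n,i}, listed exactly once.  Restricting the candidates to
-- words over {1,…,n} loses nothing, since the letters of an inversion sequence
-- of length n are at most n.  The empty sequence has no last letter.
I : (n i : ℕ) → List (Vec ℕ n)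
I zero      i = []
I n@(suc _) i =
  filter (λ ρ → isInversionSequence? ρ ×-dec (Vec.last ρ ≟ i)) (words [1⋯ n ] n)

-- (ρ₁,ρ₂), (ρ₂,ρ₃), …, (ρₙ₋₁,ρₙ)
adjacent : ∀ {n} → Vec ℕ n → Vec (ℕ × ℕ) (pred n)
adjacent []        = []
adjacent ρ@(_ ∷ _) = Vec.zip (Vec.init ρ) (Vec.tail ρ)

lev des asc : ∀ {n} → Vec ℕ n → ℕ
lev ρ = Vec.count (λ (a , b) → a ≟ b)  (adjacent ρ)
des ρ = Vec.count (λ (a , b) → a >? b) (adjacent ρ)
asc ρ = Vec.count (λ (a , b) → a <? b) (adjacent ρ)

-- The commutative rings in which 1/n! has a meaning.  The variables p, q, r, y
-- are read as arbitrary elements of such an algebra; taking them to be the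
-- indeterminates of ℚ(p,q,r,y) gives the identities of formal expressions.
record ℚ-Algebra (c ℓ : Level) : Set (Level.suc (c ⊔ ℓ)) where
  field
    commutativeRing    : CommutativeRing c ℓ
  open CommutativeRing commutativeRing public
  field
    algebraMap         : ℚ → Carrier
    isRingHomomorphism : IsRingHomomorphism ℚ.+-*-rawRing rawRing algebraMap

module GeneratingFunction {c ℓ} (A : ℚ-Algebra c ℓ) where
  open ℚ-Algebra A public
  open RawSemiringDefinitions (Semiring.rawSemiring semiring) using (_^_) renaming (_×_ to _·_)

  sumOver : ∀ {b} {B : Set b} → List B → (B → Carrier) → Carrier
  sumOver xs f = foldr (λ x s → f x + s) 0# xs

  syntax sumOver xs (λ x → e) = ∑[ x ∈ xs ] e

  -- The formal power series ring A[[x]]: f stands for Σₙ (f n) xⁿ.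
  Series : Set c
  Series = ℕ → Carrier

  infix  4 _≋_
  infixl 6 _⊕_ _⊖_
  infixr 7 _•_

  _≋_ : Series → Series → Set ℓ
  f ≋ h = ∀ n → f n ≈ h n

  const : Carrier → Series
  const a zero    = a
  const a (suc _) = 0#

  _⊕_ _⊖_ : Series → Series → Series
  (f ⊕ h) n = f n + h n
  (f ⊖ h) n = f n - h n

  _•_ : Carrier → Series → Series
  (a • f) n = a * f n

  ∂x : Series → Series
  ∂x f n = suc n · f (suc n)

  -- The substitution f(x) ↦ f(xa).
  scale : Carrier → Series → Series
  scale a f n = f n * a ^ n

  1/_! : ℕ → Carrier
  1/ n ! = algebraMap (ℚ._/_ (+ 1) (n !) {{n !≢0}})

  module _ (p q r : Carrier) where

    bₙᵢ : (n i : ℕ) → Carrier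
    bₙᵢ n i = ∑[ ρ ∈ I n i ] (p ^ lev ρ * q ^ des ρ * r ^ asc ρ)

    bₙ : ℕ → Carrier → Carrier
    bₙ n y = ∑[ i ∈ [1⋯ n ] ] (bₙᵢ n i * y ^ i)

  -- g y p q r is g(x,y;p,q,r) as a series in x.
  g : (y p q r : Carrier) → Series
  g y p q r zero      = 0#
  g y p q r n@(suc _) = bₙ p q r n y * 1/ n !

{-# OPTIONS --safe #-}
-- An inversion sequence of length n + 1 is one of length n, say with last letter j,
-- followed by a letter k ∈ {1,…,n+1}, which contributes a factor p, q or r according
-- to how j and k compare.  Summing yᵏ over k gives the geometric sums
--   q (y + ⋯ + yʲ⁻¹) + p yʲ + r (yʲ⁺¹ + ⋯ + yⁿ⁺¹)
--     = (p + (yr − q)/(1 − y)) yʲ + y/(1 − y) (q − y r yⁿ),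
-- so b_{n+1}(y) is a combination of b_n(y) and b_n(1); divided by n! this is the
-- coefficient of xⁿ in the differential equation.
module Submission where

open import Algebra.Morphism.Structures using (IsRingHomomorphism)
open import Data.Bool.Base using (true; false; if_then_else_)
open import Data.Fin.Base using (zero; suc; inject₁; fromℕ)
open import Data.Fin.Properties using (toℕ-inject₁; toℕ-fromℕ)
open import Data.Fin.Relation.Unary.Top using (view; ‵fromℕ; ‵inject₁)
open import Data.Integer.Base as ℤ using (+_)
open import Data.List.Base using (List; []; _∷_; [_]; _++_; map; filter; upTo; cartesianProductWith)
open import Data.List.Membership.Propositional using (_∈_)
open import Data.List.Membership.Propositional.Properties using (∈-map⁻; ∈-upTo⁻)
open import Data.List.Properties using (map-++; upTo-∷ʳ)
open import Data.List.Relation.Unary.Any using (here; there)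
open import Data.Maybe.Base using (Maybe; just; nothing)
open import Data.Nat.Base as ℕ using (ℕ; zero; suc; _≤_; _<_; z≤n; s≤s; _!; NonZero)
open import Data.Nat.Properties as ℕ using (_≟_; _≤?_; _<?_; _>?_; _!≢0)
open import Data.Product.Base using (_×_; _,_; proj₁; proj₂; uncurry)
open import Data.Rational.Base as ℚ using ()
open import Data.Rational.Properties as ℚ using ()
open import Data.Rational.Unnormalised.Base as ℚᵘ using (mkℚᵘ; *≡*)
open import Data.Rational.Unnormalised.Properties as ℚᵘ using ()
open import Data.Sum.Base using (inj₁; inj₂)
open import Data.Vec.Base using (Vec; []; _∷_; _∷ʳ_; lookup; count; last)
open import Data.Vec.Properties using (last-∷ʳ)
open import Function.Base using (_∘_)
open import Relation.Binary.PropositionalEquality as ≡ using (_≡_; cong; subst)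
open import Relation.Nullary using (¬_; Dec; yes; no; does; contradiction)
open import Relation.Nullary.Decidable using (_×-dec_; dec-true; dec-false)
open import Relation.Unary using (Pred; Decidable)

import Algebra.Properties.Semiring.Exp as Exp
import Algebra.Properties.Semiring.Mult as Mult
import Algebra.Solver.Ring as RingSolver
import Algebra.Solver.Ring.AlmostCommutativeRing as ACR
import Data.Integer.Properties as ℤ
import Data.Integer.Tactic.RingSolver as ℤ-Solver
import Relation.Binary.Reasoning.Setoid as SetoidReasoning

open import Defs

-- Appending a letter to a word

module _ {a p} {X : Set a} {P : Pred X p} (P? : Decidable P) where

  count-∷ʳ : ∀ {n} (xs : Vec X n) x → count P? (xs ∷ʳ x) ≡ count P? xs ℕ.+ count P? (x ∷ [])
  count-∷ʳ []       x = ≡.refl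
  count-∷ʳ (y ∷ xs) x with does (P? y)
  ... | true  = cong suc (count-∷ʳ xs x)
  ... | false = count-∷ʳ xs x

  count-yes : ∀ {x} → P x → count P? (x ∷ []) ≡ 1
  count-yes {x} Px rewrite dec-true (P? x) Px = ≡.refl

  count-no : ∀ {x} → ¬ P x → count P? (x ∷ []) ≡ 0
  count-no {x} ¬Px rewrite dec-false (P? x) ¬Px = ≡.refl

-- These three agree definitionally with the tests inside `lev`, `des` and `asc`; naming them lets
-- the counting lemmas above be applied to each statistic.
level? : Decidable (uncurry (_≡_ {A = ℕ}))
level? (a , b) = a ≟ b

descent? : Decidable (uncurry ℕ._>_)
descent? (a , b) = a >? b

ascent? : Decidable (uncurry _<_)
ascent? (a , b) = a <? b

-- The word is written `σ ∷ʳ j` so that there is a last letter for `k` to be paired with.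
adjacent-∷ʳ : ∀ {n} (σ : Vec ℕ n) j k → adjacent (σ ∷ʳ j ∷ʳ k) ≡ adjacent (σ ∷ʳ j) ∷ʳ (j , k)
adjacent-∷ʳ []          j k = ≡.refl
adjacent-∷ʳ (a ∷ [])    j k = ≡.refl
adjacent-∷ʳ (a ∷ b ∷ σ) j k = cong ((a , b) ∷_) (adjacent-∷ʳ (b ∷ σ) j k)

count-adjacent-∷ʳ : ∀ {p} {P : Pred (ℕ × ℕ) p} (P? : Decidable P) {n} (σ : Vec ℕ n) j k →
  count P? (adjacent (σ ∷ʳ j ∷ʳ k)) ≡ count P? (adjacent (σ ∷ʳ j)) ℕ.+ count P? ((j , k) ∷ [])
count-adjacent-∷ʳ P? σ j k =
  ≡.trans (cong (count P?) (adjacent-∷ʳ σ j k)) (count-∷ʳ P? (adjacent (σ ∷ʳ j)) (j , k))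

lookup-∷ʳ-inject₁ : ∀ {a} {X : Set a} {n} (xs : Vec X n) x i → lookup (xs ∷ʳ x) (inject₁ i) ≡ lookup xs i
lookup-∷ʳ-inject₁ (y ∷ xs) x zero    = ≡.refl
lookup-∷ʳ-inject₁ (y ∷ xs) x (suc i) = lookup-∷ʳ-inject₁ xs x i

lookup-∷ʳ-fromℕ : ∀ {a} {X : Set a} {n} (xs : Vec X n) x → lookup (xs ∷ʳ x) (fromℕ n) ≡ x
lookup-∷ʳ-fromℕ []       x = ≡.refl
lookup-∷ʳ-fromℕ (y ∷ xs) x = lookup-∷ʳ-fromℕ xs x

module _ {n} (ρ : Vec ℕ n) (k : ℕ) where

  -- The bound on a letter depends on its position and not on the length, so appending keeps all
  -- earlier conditions. A position of the longer word is either the top one, which holds `k`, or an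
  -- injected old one.
  IsInversionSequence-∷ʳ⁺ : IsInversionSequence ρ → 1 ≤ k → k ≤ suc n → IsInversionSequence (ρ ∷ʳ k)
  IsInversionSequence-∷ʳ⁺ inv 1≤k k≤1+n i with view i
  ... | ‵fromℕ rewrite lookup-∷ʳ-fromℕ ρ k | toℕ-fromℕ n = 1≤k , k≤1+n
  ... | ‵inject₁ j rewrite lookup-∷ʳ-inject₁ ρ k j | toℕ-inject₁ j = inv j

  IsInversionSequence-∷ʳ⁻ˡ : IsInversionSequence (ρ ∷ʳ k) → IsInversionSequence ρ
  IsInversionSequence-∷ʳ⁻ˡ inv j with inv (inject₁ j)
  ... | bounds rewrite lookup-∷ʳ-inject₁ ρ k j | toℕ-inject₁ j = bounds

  IsInversionSequence-∷ʳ⁻ʳ : IsInversionSequence (ρ ∷ʳ k) → k ≤ suc n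
  IsInversionSequence-∷ʳ⁻ʳ inv with inv (fromℕ n)
  ... | bounds rewrite lookup-∷ʳ-fromℕ ρ k | toℕ-fromℕ n = proj₂ bounds

inversionSequences : ∀ n → List (Vec ℕ n)
inversionSequences zero    = [ [] ]
inversionSequences (suc n) = cartesianProductWith _∷ʳ_ (inversionSequences n) [1⋯ suc n ]

[1⋯]-∷ʳ : ∀ n → [1⋯ suc n ] ≡ [1⋯ n ] ++ [ suc n ]
[1⋯]-∷ʳ n = ≡.trans (cong (map suc) (≡.sym (upTo-∷ʳ n))) (map-++ suc (upTo n) [ n ])

∈-[1⋯]⁻ : ∀ {n k} → k ∈ [1⋯ n ] → 1 ≤ k × k ≤ n
∈-[1⋯]⁻ k∈ with ∈-map⁻ suc k∈
... | i , i∈ , ≡.refl = s≤s z≤n , ∈-upTo⁻ i∈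

-- Fractions

fromℚᵘ-homo-+ : ∀ u v → ℚ.fromℚᵘ u ℚ.+ ℚ.fromℚᵘ v ≡ ℚ.fromℚᵘ (u ℚᵘ.+ v)
fromℚᵘ-homo-+ u v = ℚ.toℚᵘ-injective (begin
  ℚ.toℚᵘ (ℚ.fromℚᵘ u ℚ.+ ℚ.fromℚᵘ v)            ≈⟨ ℚ.toℚᵘ-homo-+ (ℚ.fromℚᵘ u) (ℚ.fromℚᵘ v) ⟩
  ℚ.toℚᵘ (ℚ.fromℚᵘ u) ℚᵘ.+ ℚ.toℚᵘ (ℚ.fromℚᵘ v)  ≈⟨ ℚᵘ.+-cong (ℚ.toℚᵘ-fromℚᵘ u) (ℚ.toℚᵘ-fromℚᵘ v) ⟩
  u ℚᵘ.+ v                                      ≈⟨ ℚ.toℚᵘ-fromℚᵘ (u ℚᵘ.+ v) ⟨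
  ℚ.toℚᵘ (ℚ.fromℚᵘ (u ℚᵘ.+ v))                  ∎)
  where open SetoidReasoning ℚᵘ.≃-setoid

-- For `d` a successor, each quotient is `fromℚᵘ` of an unnormalised fraction by definition, so the
-- claim reduces to the cross-multiplied integer identity `lemma`.
1/d+k/d≡[1+k]/d : ∀ k d .{{_ : NonZero d}} → (+ 1 ℚ./ d) ℚ.+ (+ k ℚ./ d) ≡ + suc k ℚ./ d
1/d+k/d≡[1+k]/d k (suc d) = ≡.trans (fromℚᵘ-homo-+ (mkℚᵘ (+ 1) d) (mkℚᵘ (+ k) d))
  (ℚ.fromℚᵘ-cong {mkℚᵘ (+ 1) d ℚᵘ.+ mkℚᵘ (+ k) d} {mkℚᵘ (+ suc k) d} (*≡* (lemma (+ k) (+ suc d))))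
  where
  lemma : ∀ x z → (+ 1 ℤ.* z ℤ.+ x ℤ.* z) ℤ.* z ≡ (+ 1 ℤ.+ x) ℤ.* (z ℤ.* z)
  lemma = ℤ-Solver.solve-∀

0/d≡0 : ∀ d .{{_ : NonZero d}} → + 0 ℚ./ d ≡ ℚ.0ℚ
0/d≡0 (suc d) = ℚ.fromℚᵘ-cong {mkℚᵘ (+ 0) d} {mkℚᵘ (+ 0) 0} (*≡* ≡.refl)

-- The cancellation behind (n + 1)/(n + 1)! = 1/n!, used with `d` equal to n!.
m/[m*d]≡1/d : ∀ m d .{{_ : NonZero m}} .{{_ : NonZero d}} .{{_ : NonZero (m ℕ.* d)}} →
  + m ℚ./ (m ℕ.* d) ≡ + 1 ℚ./ d
m/[m*d]≡1/d (suc m) (suc d) = ℚ.fromℚᵘ-cong {mkℚᵘ (+ suc m) _} {mkℚᵘ (+ 1) d}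
  (*≡* (≡.sym (≡.trans (ℤ.*-identityˡ _) (ℤ.pos-* (suc m) (suc d)))))

module _ {c ℓ} (A : ℚ-Algebra c ℓ) where
  open GeneratingFunction A hiding (zero)
  open Exp semiring using (_^_; ^-congʳ; ^-homo-*)
  open Mult semiring using (×-comm-*) renaming (_×_ to _·_)
  open SetoidReasoning setoid
  private module φ = IsRingHomomorphism isRingHomomorphism

  private
    -- Over the coefficients ℚ, whose equality is decidable, the solver cancels terms.
    almostCommutativeRing = ACR.fromCommutativeRing commutativeRing

    ℚ-morphism : ℚ.+-*-rawRing ACR.-Raw-AlmostCommutative⟶ almostCommutativeRing
    ℚ-morphism = record
      { ⟦_⟧    = algebraMap
      ; +-homo = φ.+-homo
      ; *-homo = φ.*-homo
      ; -‿homo = φ.-‿homo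
      ; 0-homo = φ.0#-homo
      ; 1-homo = φ.1#-homo
      }

    ℚ-equal? : ∀ u v → Maybe (algebraMap u ≈ algebraMap v)
    ℚ-equal? u v with u ℚ.≟ v
    ... | yes u≡v = just (φ.⟦⟧-cong u≡v)
    ... | no  _   = nothing

  open RingSolver ℚ.+-*-rawRing almostCommutativeRing ℚ-morphism ℚ-equal?
    using (solve; _:=_; _:+_; _:*_; _:-_)

  -- Finite sums

  module _ {b} {B : Set b} where

    sum-cong : ∀ {f h : B → Carrier} (xs : List B) → (∀ {x} → x ∈ xs → f x ≈ h x) →
      sumOver xs f ≈ sumOver xs h
    sum-cong []       f≈h = refl
    sum-cong (x ∷ xs) f≈h = +-cong (f≈h (here ≡.refl)) (sum-cong xs (f≈h ∘ there))

    sum-0 : (xs : List B) → sumOver xs (λ _ → 0#) ≈ 0#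
    sum-0 []       = refl
    sum-0 (x ∷ xs) = trans (+-identityˡ _) (sum-0 xs)

    sum-+ : ∀ (f h : B → Carrier) xs → sumOver xs (λ x → f x + h x) ≈ sumOver xs f + sumOver xs h
    sum-+ f h []       = sym (+-identityˡ 0#)
    sum-+ f h (x ∷ xs) = trans (+-congˡ (sum-+ f h xs))
      (solve 4 (λ a b s t → (a :+ b) :+ (s :+ t) := (a :+ s) :+ (b :+ t)) refl _ _ _ _)

    sum-*ˡ : ∀ a (f : B → Carrier) xs → sumOver xs (λ x → a * f x) ≈ a * sumOver xs f
    sum-*ˡ a f []       = sym (zeroʳ a)
    sum-*ˡ a f (x ∷ xs) = trans (+-congˡ (sum-*ˡ a f xs)) (sym (distribˡ a _ _))

    sum-*ʳ : ∀ a (f : B → Carrier) xs → sumOver xs (λ x → f x * a) ≈ sumOver xs f * a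
    sum-*ʳ a f []       = sym (zeroˡ a)
    sum-*ʳ a f (x ∷ xs) = trans (+-congˡ (sum-*ʳ a f xs)) (sym (distribʳ a _ _))

    sum-++ : ∀ (f : B → Carrier) xs ys → sumOver (xs ++ ys) f ≈ sumOver xs f + sumOver ys f
    sum-++ f []       ys = sym (+-identityˡ _)
    sum-++ f (x ∷ xs) ys = trans (+-congˡ (sum-++ f xs ys)) (sym (+-assoc _ _ _))

    sum-map : ∀ {d} {D : Set d} (e : D → B) (f : B → Carrier) xs →
      sumOver (map e xs) f ≈ sumOver xs (f ∘ e)
    sum-map e f []       = refl
    sum-map e f (x ∷ xs) = +-congˡ (sum-map e f xs)

    sum-cartesianProductWith : ∀ {d e} {D : Set d} {E : Set e} (_⊗_ : D → E → B) (f : B → Carrier) xs ys →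
      sumOver (cartesianProductWith _⊗_ xs ys) f ≈ sumOver xs (λ x → sumOver ys (λ z → f (x ⊗ z)))
    sum-cartesianProductWith _⊗_ f []       ys = refl
    sum-cartesianProductWith _⊗_ f (x ∷ xs) ys = trans
      (sum-++ f (map (x ⊗_) ys) _)
      (+-cong (sum-map (x ⊗_) f ys) (sum-cartesianProductWith _⊗_ f xs ys))

  sum-swap : ∀ {b d} {B : Set b} {D : Set d} (f : B → D → Carrier) xs ys →
    sumOver xs (λ x → sumOver ys (f x)) ≈ sumOver ys (λ z → sumOver xs (λ x → f x z))
  sum-swap f []       ys = sym (sum-0 ys)
  sum-swap f (x ∷ xs) ys = trans (+-congˡ (sum-swap f xs ys)) (sym (sum-+ (f x) _ ys))

  -- Conditional terms in sums

  when : ∀ {p} {P : Set p} → Dec P → Carrier → Carrier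
  when P? x = if does P? then x else 0#

  module _ {p} {P : Set p} (P? : Dec P) where

    when-yes : P → ∀ x → when P? x ≈ x
    when-yes Px x rewrite dec-true P? Px = refl

    when-no : ¬ P → ∀ x → when P? x ≈ 0#
    when-no ¬Px x rewrite dec-false P? ¬Px = refl

    when-cong : ∀ {x z} → x ≈ z → when P? x ≈ when P? z
    when-cong x≈z with does P?
    ... | true  = x≈z
    ... | false = refl

    when-*ʳ : ∀ x z → when P? x * z ≈ when P? (x * z)
    when-*ʳ x z with does P?
    ... | true  = refl
    ... | false = zeroˡ z

    when-sum : ∀ {b} {B : Set b} (f : B → Carrier) xs →
      sumOver xs (λ x → when P? (f x)) ≈ when P? (sumOver xs f)
    when-sum f xs with does P?
    ... | true  = refl
    ... | false = sum-0 xs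

    when-× : ∀ {q} {Q : Set q} (Q? : Dec Q) x → when (P? ×-dec Q?) x ≈ when P? (when Q? x)
    when-× Q? x with does P?
    ... | true  = refl
    ... | false = refl

  when-⇔ : ∀ {p q} {P : Set p} {Q : Set q} (P? : Dec P) (Q? : Dec Q) → (P → Q) → (Q → P) →
    ∀ x → when P? x ≈ when Q? x
  when-⇔ P? (yes Qx) to from x = when-yes P? (from Qx) x
  when-⇔ P? (no ¬Qx) to from x = when-no P? (¬Qx ∘ to) x

  -- Trades the filter in the definition of `I` for a condition on the terms. All sums then run over
  -- fixed lists and can be exchanged.
  sum-filter : ∀ {b p} {B : Set b} {P : Pred B p} (P? : Decidable P) (f : B → Carrier) xs →
    sumOver (filter P? xs) f ≈ sumOver xs (λ x → when (P? x) (f x))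
  sum-filter P? f []       = refl
  sum-filter P? f (x ∷ xs) with does (P? x)
  ... | true  = +-congˡ (sum-filter P? f xs)
  ... | false = trans (sum-filter P? f xs) (sym (+-identityˡ _))

  sum-[1⋯suc] : ∀ f n → sumOver [1⋯ suc n ] f ≈ sumOver [1⋯ n ] f + f (suc n)
  sum-[1⋯suc] f n = trans (reflexive (cong (λ xs → sumOver xs f) ([1⋯]-∷ʳ n)))
    (trans (sum-++ f [1⋯ n ] [ suc n ]) (+-congˡ (+-identityʳ _)))

  -- A Kronecker delta. It removes the sum over the prescribed last letter i from `bₙ`.
  sum-[1⋯]-select : ∀ (f : ℕ → Carrier) j n → 1 ≤ j → j ≤ n → sumOver [1⋯ n ] (λ i → when (j ≟ i) (f i)) ≈ f j
  sum-[1⋯]-select f j zero    1≤j j≤0 = contradiction (ℕ.≤-trans 1≤j j≤0) λ ()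
  sum-[1⋯]-select f j (suc n) 1≤j j≤1+n with ℕ.m≤n⇒m<n∨m≡n j≤1+n
  ... | inj₁ (s≤s j≤n) = begin
    sumOver [1⋯ suc n ] (λ i → when (j ≟ i) (f i))                         ≈⟨ sum-[1⋯suc] _ n ⟩
    sumOver [1⋯ n ] (λ i → when (j ≟ i) (f i)) + when (j ≟ suc n) (f (suc n))
      ≈⟨ +-cong (sum-[1⋯]-select f j n 1≤j j≤n) (when-no (j ≟ suc n) (ℕ.<⇒≢ (s≤s j≤n)) _) ⟩
    f j + 0#                                                               ≈⟨ +-identityʳ _ ⟩
    f j                                                                    ∎
  ... | inj₂ ≡.refl = begin
    sumOver [1⋯ j ] (λ i → when (j ≟ i) (f i))                             ≈⟨ sum-[1⋯suc] _ n ⟩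
    sumOver [1⋯ n ] (λ i → when (j ≟ i) (f i)) + when (j ≟ j) (f j)
      ≈⟨ +-cong (sum-cong [1⋯ n ] λ {i} i∈ → when-no (j ≟ i) (ℕ.>⇒≢ (s≤s (proj₂ (∈-[1⋯]⁻ i∈)))) _)
                (when-yes (j ≟ j) ≡.refl _) ⟩
    sumOver [1⋯ n ] (λ _ → 0#) + f j                                       ≈⟨ +-congʳ (sum-0 [1⋯ n ]) ⟩
    0# + f j                                                               ≈⟨ +-identityˡ _ ⟩
    f j                                                                    ∎

  -- The upper limit has the form `d ℕ.+ l` to allow induction on the excess `d`; each extra top
  -- term fails the condition.
  sum-[1⋯]-truncate : ∀ f l d →
    sumOver [1⋯ d ℕ.+ l ] (λ k → when (k ≤? l) (f k)) ≈ sumOver [1⋯ l ] f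
  sum-[1⋯]-truncate f l zero    = sum-cong [1⋯ l ] λ {k} k∈ → when-yes (k ≤? l) (proj₂ (∈-[1⋯]⁻ k∈)) _
  sum-[1⋯]-truncate f l (suc d) = begin
    sumOver [1⋯ suc d ℕ.+ l ] (λ k → when (k ≤? l) (f k))                  ≈⟨ sum-[1⋯suc] _ (d ℕ.+ l) ⟩
    sumOver [1⋯ d ℕ.+ l ] (λ k → when (k ≤? l) (f k)) + when (suc (d ℕ.+ l) ≤? l) (f (suc (d ℕ.+ l)))
      ≈⟨ +-cong (sum-[1⋯]-truncate f l d) (when-no (suc (d ℕ.+ l) ≤? l) (ℕ.m+n≮n d l) _) ⟩
    sumOver [1⋯ l ] f + 0#                                                 ≈⟨ +-identityʳ _ ⟩
    sumOver [1⋯ l ] f                                                      ∎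

  -- Sums over inversion sequences

  -- Reconciles the two directions of growth: `words` adds letters in front, while the recursion for
  -- inversion sequences adds them at the end.
  sum-words-∷ʳ : ∀ letters n (F : Vec ℕ (suc n) → Carrier) →
    sumOver (words letters (suc n)) F ≈ sumOver (words letters n) (λ ρ → sumOver letters (λ k → F (ρ ∷ʳ k)))
  sum-words-∷ʳ letters zero F = begin
    sumOver (words letters 1) F                            ≈⟨ sum-cartesianProductWith _∷_ F letters _ ⟩
    -- Each `+ 0#` in this case closes the fold over the one-element list of empty words.
    sumOver letters (λ k → F (k ∷ []) + 0#)                ≈⟨ sum-cong letters (λ _ → +-identityʳ _) ⟩
    sumOver letters (λ k → F (k ∷ []))                     ≈⟨ +-identityʳ _ ⟨
    sumOver letters (λ k → F (k ∷ [])) + 0#                ∎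
  sum-words-∷ʳ letters (suc n) F = begin
    sumOver (words letters (suc (suc n))) F
      ≈⟨ sum-cartesianProductWith _∷_ F letters _ ⟩
    sumOver letters (λ a → sumOver (words letters (suc n)) (λ ρ → F (a ∷ ρ)))
      ≈⟨ sum-cong letters (λ {a} _ → sum-words-∷ʳ letters n (λ ρ → F (a ∷ ρ))) ⟩
    sumOver letters (λ a → sumOver (words letters n) (λ ρ → sumOver letters (λ k → F ((a ∷ ρ) ∷ʳ k))))
      ≈⟨ sum-cartesianProductWith _∷_ _ letters _ ⟨
    sumOver (words letters (suc n)) (λ ρ → sumOver letters (λ k → F (ρ ∷ʳ k)))
      ∎

  -- The alphabet size `m` is kept apart from the length `n`, because the induction shortens the
  -- words while their alphabet stays the same.
  sum-inversionSequences : ∀ n m → n ≤ m → (F : Vec ℕ n → Carrier) →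
    sumOver (words [1⋯ m ] n) (λ ρ → when (isInversionSequence? ρ) (F ρ)) ≈ sumOver (inversionSequences n) F
  sum-inversionSequences zero    m _   F = refl
  sum-inversionSequences (suc n) m n<m F = begin
    sumOver (words [1⋯ m ] (suc n)) (λ ρ → when (isInversionSequence? ρ) (F ρ))
      ≈⟨ sum-words-∷ʳ [1⋯ m ] n _ ⟩
    sumOver (words [1⋯ m ] n) (λ ρ → sumOver [1⋯ m ] (λ k → when (isInversionSequence? (ρ ∷ʳ k)) (F (ρ ∷ʳ k))))
      ≈⟨ sum-cong (words [1⋯ m ] n) (λ {ρ} _ → extensions ρ) ⟩
    sumOver (words [1⋯ m ] n) (λ ρ → when (isInversionSequence? ρ) (sumOver [1⋯ suc n ] (λ k → F (ρ ∷ʳ k))))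
      ≈⟨ sum-inversionSequences n m (ℕ.<⇒≤ n<m) _ ⟩
    sumOver (inversionSequences n) (λ ρ → sumOver [1⋯ suc n ] (λ k → F (ρ ∷ʳ k)))
      ≈⟨ sum-cartesianProductWith _∷ʳ_ F (inversionSequences n) [1⋯ suc n ] ⟨
    sumOver (inversionSequences (suc n)) F
      ∎
    where
    truncate : ∀ f → sumOver [1⋯ m ] (λ k → when (k ≤? suc n) (f k)) ≈ sumOver [1⋯ suc n ] f
    truncate f = subst (λ m → sumOver [1⋯ m ] (λ k → when (k ≤? suc n) (f k)) ≈ sumOver [1⋯ suc n ] f)
      (ℕ.m∸n+n≡m n<m) (sum-[1⋯]-truncate f (suc n) (m ℕ.∸ suc n))

    extensions : ∀ ρ → sumOver [1⋯ m ] (λ k → when (isInversionSequence? (ρ ∷ʳ k)) (F (ρ ∷ʳ k)))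
      ≈ when (isInversionSequence? ρ) (sumOver [1⋯ suc n ] (λ k → F (ρ ∷ʳ k)))
    extensions ρ = begin
      sumOver [1⋯ m ] (λ k → when (isInversionSequence? (ρ ∷ʳ k)) (F (ρ ∷ʳ k)))
        -- Membership of `k` in {1,...,m} supplies its lower bound, so the only condition left on
        -- the new letter is `k ≤ suc n`.
        ≈⟨ sum-cong [1⋯ m ] (λ {k} k∈ → trans
             (when-⇔ (isInversionSequence? (ρ ∷ʳ k)) (isInversionSequence? ρ ×-dec (k ≤? suc n))
               (λ inv → IsInversionSequence-∷ʳ⁻ˡ ρ k inv , IsInversionSequence-∷ʳ⁻ʳ ρ k inv)
               (uncurry λ inv k≤ → IsInversionSequence-∷ʳ⁺ ρ k inv (proj₁ (∈-[1⋯]⁻ k∈)) k≤) _)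
             (when-× (isInversionSequence? ρ) (k ≤? suc n) _)) ⟩
      sumOver [1⋯ m ] (λ k → when (isInversionSequence? ρ) (when (k ≤? suc n) (F (ρ ∷ʳ k))))
        ≈⟨ when-sum (isInversionSequence? ρ) _ [1⋯ m ] ⟩
      when (isInversionSequence? ρ) (sumOver [1⋯ m ] (λ k → when (k ≤? suc n) (F (ρ ∷ʳ k))))
        ≈⟨ when-cong (isInversionSequence? ρ) (truncate _) ⟩
      when (isInversionSequence? ρ) (sumOver [1⋯ suc n ] (λ k → F (ρ ∷ʳ k)))
        ∎

  -- The numbers 1/n!

  -- `∂x` multiplies by repeated addition in the ring; this carries that multiple into ℚ, where the
  -- fraction can be reduced.
  ·-algebraMap : ∀ k d .{{_ : NonZero d}} → k · algebraMap (+ 1 ℚ./ d) ≈ algebraMap (+ k ℚ./ d)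
  ·-algebraMap zero    d = trans (sym φ.0#-homo) (φ.⟦⟧-cong (≡.sym (0/d≡0 d)))
  ·-algebraMap (suc k) d = begin
    algebraMap (+ 1 ℚ./ d) + k · algebraMap (+ 1 ℚ./ d)  ≈⟨ +-congˡ (·-algebraMap k d) ⟩
    algebraMap (+ 1 ℚ./ d) + algebraMap (+ k ℚ./ d)      ≈⟨ φ.+-homo _ _ ⟨
    algebraMap ((+ 1 ℚ./ d) ℚ.+ (+ k ℚ./ d))             ≈⟨ φ.⟦⟧-cong (1/d+k/d≡[1+k]/d k d) ⟩
    algebraMap (+ suc k ℚ./ d)                           ∎

  ·-1/[1+n]! : ∀ n → suc n · 1/ suc n ! ≈ 1/ n !
  ·-1/[1+n]! n = trans (·-algebraMap (suc n) (suc n !) {{suc n !≢0}})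
    (φ.⟦⟧-cong (m/[m*d]≡1/d (suc n) (n !) {{_}} {{n !≢0}} {{suc n !≢0}}))

  1^n≈1 : ∀ n → 1# ^ n ≈ 1#
  1^n≈1 zero    = refl
  1^n≈1 (suc n) = trans (*-identityˡ _) (1^n≈1 n)

  -- Weights of words and the polynomials `bₙ`

  module _ (p q r : Carrier) where

    weight : ∀ {n} → Vec ℕ n → Carrier
    weight ρ = p ^ lev ρ * q ^ des ρ * r ^ asc ρ

    -- Appending `k` creates exactly one new adjacent pair, so each statistic grows by its value on
    -- the two-letter word `j ∷ k ∷ []`, and powers turn this sum into a product.
    weight-∷ʳ : ∀ {n} (σ : Vec ℕ n) j k → weight (σ ∷ʳ j ∷ʳ k) ≈ weight (σ ∷ʳ j) * weight (j ∷ k ∷ [])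
    weight-∷ʳ σ j k = begin
      weight (σ ∷ʳ j ∷ʳ k)
        ≈⟨ *-cong (*-cong (split p level?) (split q descent?))
                  (split r ascent?) ⟩
      (p ^ lev (σ ∷ʳ j) * p ^ lev jk) * (q ^ des (σ ∷ʳ j) * q ^ des jk) * (r ^ asc (σ ∷ʳ j) * r ^ asc jk)
        ≈⟨ solve 6 (λ a a′ b b′ c c′ →
             (a :* a′) :* (b :* b′) :* (c :* c′) := (a :* b :* c) :* (a′ :* b′ :* c′)) refl _ _ _ _ _ _ ⟩
      weight (σ ∷ʳ j) * weight jk
        ∎
      where
      jk = j ∷ k ∷ []

      split : ∀ x {P : Pred (ℕ × ℕ) _} (P? : Decidable P) → x ^ count P? (adjacent (σ ∷ʳ j ∷ʳ k))
        ≈ x ^ count P? (adjacent (σ ∷ʳ j)) * x ^ count P? (adjacent jk)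
      split x P? = trans (^-congʳ x (count-adjacent-∷ʳ P? σ j k))
        (^-homo-* x (count P? (adjacent (σ ∷ʳ j))) (count P? (adjacent jk)))

    private
      weight-pair : ∀ j k {l d a} →
        lev (j ∷ k ∷ []) ≡ l → des (j ∷ k ∷ []) ≡ d → asc (j ∷ k ∷ []) ≡ a →
        weight (j ∷ k ∷ []) ≈ p ^ l * q ^ d * r ^ a
      weight-pair j k ≡.refl ≡.refl ≡.refl = refl

    weight-level : ∀ j → weight (j ∷ j ∷ []) ≈ p
    weight-level j = begin
      weight (j ∷ j ∷ [])  ≈⟨ weight-pair j j (count-yes level? {j , j} ≡.refl)
                                (count-no descent? {j , j} (ℕ.<-irrefl ≡.refl))
                                (count-no ascent? {j , j} (ℕ.<-irrefl ≡.refl)) ⟩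
      p * 1# * 1# * 1#     ≈⟨ trans (*-identityʳ _) (trans (*-identityʳ _) (*-identityʳ _)) ⟩
      p                    ∎

    weight-descent : ∀ {j k} → k < j → weight (j ∷ k ∷ []) ≈ q
    weight-descent {j} {k} k<j = begin
      weight (j ∷ k ∷ [])  ≈⟨ weight-pair j k (count-no level? {j , k} (ℕ.>⇒≢ k<j))
                                (count-yes descent? {j , k} k<j)
                                (count-no ascent? {j , k} (ℕ.<-asym k<j)) ⟩
      1# * (q * 1#) * 1#   ≈⟨ trans (*-identityʳ _) (trans (*-identityˡ _) (*-identityʳ _)) ⟩
      q                    ∎

    weight-ascent : ∀ {j k} → j < k → weight (j ∷ k ∷ []) ≈ r
    weight-ascent {j} {k} j<k = begin
      weight (j ∷ k ∷ [])  ≈⟨ weight-pair j k (count-no level? {j , k} (ℕ.<⇒≢ j<k))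
                                (count-no descent? {j , k} (ℕ.<-asym j<k))
                                (count-yes ascent? {j , k} j<k) ⟩
      1# * 1# * (r * 1#)   ≈⟨ trans (*-cong (*-identityʳ _) (*-identityʳ _)) (*-identityˡ _) ⟩
      r                    ∎

    -- After the two sums are exchanged, each inversion sequence meets a sum over i in which only
    -- its own last letter survives. That letter `k` is split off because it is the exponent of `y`.
    bₙ-as-sum : ∀ n y → bₙ p q r (suc n) y
      ≈ sumOver (inversionSequences n) (λ σ → sumOver [1⋯ suc n ] (λ k → weight (σ ∷ʳ k) * y ^ k))
    bₙ-as-sum n y = begin
      sumOver [1⋯ N ] (λ i → bₙᵢ p q r N i * y ^ i)
        ≈⟨ sum-cong [1⋯ N ] (λ {i} _ → term i) ⟩
      sumOver [1⋯ N ] (λ i → sumOver (words [1⋯ N ] N) (λ ρ →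
        when (isInversionSequence? ρ) (when (last ρ ≟ i) (weight ρ * y ^ i))))
        ≈⟨ sum-swap _ [1⋯ N ] (words [1⋯ N ] N) ⟩
      sumOver (words [1⋯ N ] N) (λ ρ → sumOver [1⋯ N ] (λ i →
        when (isInversionSequence? ρ) (when (last ρ ≟ i) (weight ρ * y ^ i))))
        ≈⟨ sum-cong (words [1⋯ N ] N) (λ {ρ} _ → when-sum (isInversionSequence? ρ) _ [1⋯ N ]) ⟩
      sumOver (words [1⋯ N ] N) (λ ρ → when (isInversionSequence? ρ)
        (sumOver [1⋯ N ] (λ i → when (last ρ ≟ i) (weight ρ * y ^ i))))
        ≈⟨ sum-inversionSequences N N ℕ.≤-refl _ ⟩
      sumOver (inversionSequences N) (λ ρ → sumOver [1⋯ N ] (λ i → when (last ρ ≟ i) (weight ρ * y ^ i)))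
        ≈⟨ sum-cartesianProductWith _∷ʳ_ _ (inversionSequences n) [1⋯ N ] ⟩
      sumOver (inversionSequences n) (λ σ → sumOver [1⋯ N ] (λ k →
        sumOver [1⋯ N ] (λ i → when (last (σ ∷ʳ k) ≟ i) (weight (σ ∷ʳ k) * y ^ i))))
        ≈⟨ sum-cong (inversionSequences n) (λ {σ} _ → sum-cong [1⋯ N ] (λ k∈ → select σ (∈-[1⋯]⁻ k∈))) ⟩
      sumOver (inversionSequences n) (λ σ → sumOver [1⋯ N ] (λ k → weight (σ ∷ʳ k) * y ^ k))
        ∎
      where
      N = suc n

      term : ∀ i → bₙᵢ p q r N i * y ^ i ≈ sumOver (words [1⋯ N ] N) (λ ρ →
        when (isInversionSequence? ρ) (when (last ρ ≟ i) (weight ρ * y ^ i)))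
      term i = begin
        bₙᵢ p q r N i * y ^ i
          ≈⟨ *-congʳ (sum-filter (λ ρ → isInversionSequence? ρ ×-dec (last ρ ≟ i)) weight (words [1⋯ N ] N)) ⟩
        sumOver (words [1⋯ N ] N) (λ ρ → when (isInversionSequence? ρ ×-dec (last ρ ≟ i)) (weight ρ)) * y ^ i
          ≈⟨ sum-*ʳ (y ^ i) _ (words [1⋯ N ] N) ⟨
        sumOver (words [1⋯ N ] N) (λ ρ → when (isInversionSequence? ρ ×-dec (last ρ ≟ i)) (weight ρ) * y ^ i)
          ≈⟨ sum-cong (words [1⋯ N ] N) (λ {ρ} _ → trans
               (when-*ʳ (isInversionSequence? ρ ×-dec (last ρ ≟ i)) _ _)
               (when-× (isInversionSequence? ρ) (last ρ ≟ i) _)) ⟩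
        sumOver (words [1⋯ N ] N) (λ ρ → when (isInversionSequence? ρ) (when (last ρ ≟ i) (weight ρ * y ^ i)))
          ∎

      select : ∀ σ {k} → 1 ≤ k × k ≤ N →
        sumOver [1⋯ N ] (λ i → when (last (σ ∷ʳ k) ≟ i) (weight (σ ∷ʳ k) * y ^ i)) ≈ weight (σ ∷ʳ k) * y ^ k
      select σ {k} (1≤k , k≤N) rewrite last-∷ʳ k σ =
        sum-[1⋯]-select (λ i → weight (σ ∷ʳ k) * y ^ i) k N 1≤k k≤N

    bₙ-1 : ∀ y → bₙ p q r 1 y ≈ y
    bₙ-1 y = begin
      bₙ p q r 1 y                             ≈⟨ bₙ-as-sum 0 y ⟩
      -- The only word is the single letter 1, with no adjacent pair: three zeroth powers, and one
      -- `0#` from the end of each of the two sums.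
      1# * 1# * 1# * (y * 1#) + 0# + 0#        ≈⟨ trans (+-identityʳ _) (+-identityʳ _) ⟩
      1# * 1# * 1# * (y * 1#)
        ≈⟨ *-cong (trans (*-identityʳ _) (*-identityʳ _)) (*-identityʳ y) ⟩
      1# * y                                   ≈⟨ *-identityˡ y ⟩
      y                                        ∎

    -- The factor n + 1 turns 1/(n + 1)! into 1/n!: differentiating an exponential generating
    -- function shifts its coefficients.
    ∂x-g : ∀ n y → ∂x (g y p q r) n ≈ bₙ p q r (suc n) y * 1/ n !
    ∂x-g n y = begin
      suc n · (bₙ p q r (suc n) y * 1/ suc n !)  ≈⟨ ×-comm-* (suc n) _ _ ⟨
      bₙ p q r (suc n) y * (suc n · 1/ suc n !)  ≈⟨ *-congˡ (·-1/[1+n]! n) ⟩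
      bₙ p q r (suc n) y * 1/ n !                ∎

    -- Geometric sums over the next letter, with `inv` as 1/(1 - y), and the recurrence

    module _ (y inv : Carrier) (1-y*inv≈1 : (1# - y) * inv ≈ 1#) where

      -- Brings a single term over the denominator 1 - y, so that it telescopes with a geometric sum
      -- already in closed form.
      *-expand-1 : ∀ z → z ≈ z * inv - z * y * inv
      *-expand-1 z = begin
        z                              ≈⟨ *-identityʳ z ⟨
        z * 1#                         ≈⟨ *-congˡ 1-y*inv≈1 ⟨
        z * ((1# - y) * inv)           ≈⟨ solve 4 (λ z e y i → z :* ((e :- y) :* i)
                                                    := (z :* e) :* i :- z :* y :* i) refl z 1# y inv ⟩
        z * 1# * inv - z * y * inv     ≈⟨ +-congʳ (*-congʳ (*-identityʳ z)) ⟩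
        z * inv - z * y * inv          ∎

      -- All letters up to `m` lie below `j`, so this is `q` times a geometric sum. It is needed at
      -- m = j - 1; a general `m` makes the induction possible.
      sum-descents : ∀ j m → m < j →
        sumOver [1⋯ m ] (λ k → weight (j ∷ k ∷ []) * y ^ k) ≈ y * inv * (q - q * y ^ m)
      sum-descents j zero    _   = sym (begin
        y * inv * (q - q * 1#)  ≈⟨ *-congˡ (+-congˡ (-‿cong (*-identityʳ q))) ⟩
        y * inv * (q - q)       ≈⟨ *-congˡ (-‿inverseʳ q) ⟩
        y * inv * 0#            ≈⟨ zeroʳ _ ⟩
        0#                      ∎)
      sum-descents j (suc m) m<j = begin
        sumOver [1⋯ suc m ] (λ k → weight (j ∷ k ∷ []) * y ^ k)
          ≈⟨ sum-[1⋯suc] _ m ⟩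
        sumOver [1⋯ m ] (λ k → weight (j ∷ k ∷ []) * y ^ k) + weight (j ∷ suc m ∷ []) * y ^ suc m
          ≈⟨ +-cong (sum-descents j m (ℕ.<⇒≤ m<j)) (trans (*-congʳ (weight-descent m<j)) (*-expand-1 _)) ⟩
        y * inv * (q - q * y ^ m) + (q * (y * y ^ m) * inv - q * (y * y ^ m) * y * inv)
          -- Telescoping: the term subtracted in the sum so far is `q * (y * y ^ m) * inv`, the
          -- first half of the new term.
          ≈⟨ solve 4 (λ y i q Y → y :* i :* (q :- q :* Y) :+ (q :* (y :* Y) :* i :- q :* (y :* Y) :* y :* i)
               := y :* i :* (q :- q :* (y :* Y))) refl y inv q (y ^ m) ⟩
        y * inv * (q - q * y ^ suc m)
          ∎

      -- Induction on `d`, the number of letters above `j`. The base case joins the descents to the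
      -- level, and each step adds one ascent, which telescopes as before.
      sum-next-letter : ∀ j d → 1 ≤ j → sumOver [1⋯ d ℕ.+ j ] (λ k → weight (j ∷ k ∷ []) * y ^ k)
        ≈ (p + (y * r - q) * inv) * y ^ j + y * inv * (q - r * y ^ (d ℕ.+ j))
      sum-next-letter j@(suc i) zero 1≤j = begin
        sumOver [1⋯ j ] (λ k → weight (j ∷ k ∷ []) * y ^ k)
          ≈⟨ sum-[1⋯suc] _ i ⟩
        sumOver [1⋯ i ] (λ k → weight (j ∷ k ∷ []) * y ^ k) + weight (j ∷ j ∷ []) * y ^ j
          ≈⟨ +-cong (sum-descents j i ℕ.≤-refl) (*-congʳ (weight-level j)) ⟩
        y * inv * (q - q * y ^ i) + p * y ^ j
          -- There is no ascent yet: the two terms with `r` on the right cancel each other.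
          ≈⟨ solve 6 (λ y v p q r Y → y :* v :* (q :- q :* Y) :+ p :* (y :* Y)
               := (p :+ (y :* r :- q) :* v) :* (y :* Y) :+ y :* v :* (q :- r :* (y :* Y)))
               refl y inv p q r (y ^ i) ⟩
        (p + (y * r - q) * inv) * y ^ j + y * inv * (q - r * y ^ j)
          ∎
      sum-next-letter j (suc d) 1≤j = begin
        sumOver [1⋯ suc m ] (λ k → weight (j ∷ k ∷ []) * y ^ k)
          ≈⟨ sum-[1⋯suc] _ m ⟩
        sumOver [1⋯ m ] (λ k → weight (j ∷ k ∷ []) * y ^ k) + weight (j ∷ suc m ∷ []) * y ^ suc m
          ≈⟨ +-cong (sum-next-letter j d 1≤j)
                    (trans (*-congʳ (weight-ascent (s≤s (ℕ.m≤n+m j d)))) (*-expand-1 _)) ⟩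
        c′ * y ^ j + y * inv * (q - r * y ^ m) + (r * (y * y ^ m) * inv - r * (y * y ^ m) * y * inv)
          ≈⟨ solve 6 (λ y v q r Y C → C :+ y :* v :* (q :- r :* Y)
                 :+ (r :* (y :* Y) :* v :- r :* (y :* Y) :* y :* v)
               := C :+ y :* v :* (q :- r :* (y :* Y))) refl y inv q r (y ^ m) (c′ * y ^ j) ⟩
        c′ * y ^ j + y * inv * (q - r * y ^ suc m)
          ∎
        where
        m  = d ℕ.+ j
        c′ = p + (y * r - q) * inv

      -- In the sum over the next letter, the part proportional to y^j rebuilds `bₙ` at `y`. The
      -- rest does not depend on j, so it multiplies the bare weights, whose sum is `bₙ` at `1#`.
      -- The shorter words have length n + 1, so that a preceding letter exists.
      bₙ-recurrence : ∀ n → bₙ p q r (2 ℕ.+ n) y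
        ≈ (p + (y * r - q) * inv) * bₙ p q r (suc n) y
          + y * inv * (q - r * y ^ (2 ℕ.+ n)) * bₙ p q r (suc n) 1#
      bₙ-recurrence n = begin
        bₙ p q r (suc N) y
          ≈⟨ bₙ-as-sum N y ⟩
        sumOver (inversionSequences N) (λ ρ → sumOver [1⋯ suc N ] (λ k → weight (ρ ∷ʳ k) * y ^ k))
          ≈⟨ sum-cartesianProductWith _∷ʳ_ _ S [1⋯ N ] ⟩
        sumOver S (λ σ → sumOver [1⋯ N ] (λ j → sumOver [1⋯ suc N ] (λ k → weight (σ ∷ʳ j ∷ʳ k) * y ^ k)))
          ≈⟨ sum-cong S (λ {σ} _ → trans
               (sum-cong [1⋯ N ] (λ j∈ → extensions σ (∈-[1⋯]⁻ j∈)))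
               (linear [1⋯ N ] _ _)) ⟩
        sumOver S (λ σ → u * sumOver [1⋯ N ] (λ j → weight (σ ∷ʳ j) * y ^ j)
                         + v * sumOver [1⋯ N ] (λ j → weight (σ ∷ʳ j) * 1# ^ j))
          ≈⟨ linear S _ _ ⟩
        u * sumOver S (λ σ → sumOver [1⋯ N ] (λ j → weight (σ ∷ʳ j) * y ^ j))
          + v * sumOver S (λ σ → sumOver [1⋯ N ] (λ j → weight (σ ∷ʳ j) * 1# ^ j))
          ≈⟨ +-cong (*-congˡ (bₙ-as-sum n y)) (*-congˡ (bₙ-as-sum n 1#)) ⟨
        u * bₙ p q r N y + v * bₙ p q r N 1#
          ∎
        where
        N = suc n
        S = inversionSequences n
        u = p + (y * r - q) * inv
        v = y * inv * (q - r * y ^ suc N)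

        linear : ∀ {b} {B : Set b} (xs : List B) (f h : B → Carrier) →
          sumOver xs (λ x → u * f x + v * h x) ≈ u * sumOver xs f + v * sumOver xs h
        linear xs f h = trans (sum-+ _ _ xs) (+-cong (sum-*ˡ u f xs) (sum-*ˡ v h xs))

        extensions : ∀ (σ : Vec ℕ n) {j} → 1 ≤ j × j ≤ N →
          sumOver [1⋯ suc N ] (λ k → weight (σ ∷ʳ j ∷ʳ k) * y ^ k)
            ≈ u * (weight (σ ∷ʳ j) * y ^ j) + v * (weight (σ ∷ʳ j) * 1# ^ j)
        extensions σ {j} (1≤j , j≤N) = begin
          sumOver [1⋯ suc N ] (λ k → weight (σ ∷ʳ j ∷ʳ k) * y ^ k)
            ≈⟨ sum-cong [1⋯ suc N ] (λ {k} _ → trans (*-congʳ (weight-∷ʳ σ j k)) (*-assoc _ _ _)) ⟩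
          sumOver [1⋯ suc N ] (λ k → w * (weight (j ∷ k ∷ []) * y ^ k))
            ≈⟨ sum-*ˡ w _ [1⋯ suc N ] ⟩
          w * sumOver [1⋯ suc N ] (λ k → weight (j ∷ k ∷ []) * y ^ k)
            -- The top letter n + 2 is written as d + j, where d = n + 2 - j is the number of
            -- possible ascents.
            ≈⟨ *-congˡ (subst (λ m → sumOver [1⋯ m ] (λ k → weight (j ∷ k ∷ []) * y ^ k)
                                  ≈ u * y ^ j + y * inv * (q - r * y ^ m))
                 (ℕ.m∸n+n≡m (ℕ.m≤n⇒m≤1+n j≤N)) (sum-next-letter j (suc N ℕ.∸ j) 1≤j)) ⟩
          w * (u * y ^ j + v)
            ≈⟨ solve 4 (λ w u Y v → w :* (u :* Y :+ v) := u :* (w :* Y) :+ v :* w) refl w u (y ^ j) v ⟩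
          u * (w * y ^ j) + v * w
            -- The factor `1# ^ j` is inserted to match the summand of `bₙ` at `1#`.
            ≈⟨ +-congˡ (*-congˡ (trans (*-congˡ (1^n≈1 j)) (*-identityʳ w))) ⟨
          u * (w * y ^ j) + v * (w * 1# ^ j)
            ∎
          where w = weight (σ ∷ʳ j)

      -- The differential equation, coefficient by coefficient

      ∂x-g-equation : ∂x (g y p q r)
        ≋ const y
          ⊕ (p + (y * r - q) * inv) • g y p q r
          ⊕ (y * inv) • (q • g 1# p q r ⊖ (y * r) • scale y (g 1# p q r))
      ∂x-g-equation zero = begin
        -- The recurrence starts one degree later. Here every series built from `g` has constant
        -- coefficient zero, leaving `y` on both sides.
        ∂x (g y p q r) 0                  ≈⟨ ∂x-g 0 y ⟩
        bₙ p q r 1 y * 1/ 0 !             ≈⟨ trans (*-cong (bₙ-1 y) φ.1#-homo) (*-identityʳ y) ⟩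
        y                                 ≈⟨ +-identityʳ y ⟨
        y + 0#                            ≈⟨ +-congˡ (zeroʳ _) ⟨
        y + u * 0#                        ≈⟨ +-identityʳ _ ⟨
        y + u * 0# + 0#                   ≈⟨ +-congˡ (trans (*-congˡ vanishing) (zeroʳ _)) ⟨
        y + u * 0# + y * inv * (q * 0# - y * r * (0# * 1#))  ∎
        where
        u = p + (y * r - q) * inv

        vanishing : q * 0# - y * r * (0# * 1#) ≈ 0#
        vanishing = trans (+-cong (zeroʳ q) (-‿cong (trans (*-congˡ (zeroˡ 1#)) (zeroʳ _)))) (-‿inverseʳ 0#)
      ∂x-g-equation (suc n) = begin
        ∂x (g y p q r) N                  ≈⟨ ∂x-g N y ⟩
        bₙ p q r (suc N) y * f            ≈⟨ *-congʳ (bₙ-recurrence n) ⟩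
        (u * b + y * inv * (q - r * (y * y ^ N)) * b₁) * f
          -- The power y^(n + 2) is shared out: one factor `y` joins `r` in the coefficient, and
          -- `y ^ N` is what the substitution of xy for x contributes in degree `N`.
          ≈⟨ solve 9 (λ u b y v q r Y b₁ f → (u :* b :+ y :* v :* (q :- r :* (y :* Y)) :* b₁) :* f
               := u :* (b :* f) :+ y :* v :* (q :* (b₁ :* f) :- y :* r :* (b₁ :* f :* Y)))
               refl u b y inv q r (y ^ N) b₁ f ⟩
        u * (b * f) + y * inv * (q * (b₁ * f) - y * r * (b₁ * f * y ^ N))
          -- The new `0#` is the coefficient of `const y` in positive degree.
          ≈⟨ +-congʳ (+-identityˡ _) ⟨
        0# + u * (b * f) + y * inv * (q * (b₁ * f) - y * r * (b₁ * f * y ^ N))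
          ∎
        where
        N  = suc n
        u  = p + (y * r - q) * inv
        b  = bₙ p q r N y
        b₁ = bₙ p q r N 1#
        f  = 1/ N !

theorem3p3 : ∀ {c ℓ} (A : ℚ-Algebra c ℓ) → let open GeneratingFunction A in
    (y p q r inv : Carrier) → (1# - y) * inv ≈ 1# →
    ∂x (g y p q r)
    ≋ const y
    ⊕ (p + (y * r - q) * inv) • g y p q r
    ⊕ (y * inv) • (q • g 1# p q r ⊖ (y * r) • scale y (g 1# p q r))
theorem3p3 A y p q r inv 1-y*inv≈1 = ∂x-g-equation A p q r y inv 1-y*inv≈1
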